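{- Let $d \ge 1$ be an integer. The vertices of the Gardner polytope $\mathcal{G}_d \subset \mathbb{R}^{d\times d}$ are exactly the matrices $R_1,\dots,R_d,C_1,\dots,C_d$.
   Context: Let $[d]=\{1,\dots,d\}$. A matrix $A\in\mathbb{R}^{d\times d}$ is a $G$-matrix of value $N\in\mathbb{R}_{\ge 0}$ if all its entries are nonnegative and $A_{1,\sigma(1)}+A_{2,\sigma(2)}+\cdots+A_{d,\sigma(d)}=N$ for every permutation $\sigma$ of $[d]$. The Gardner polytope $\mathcal{G}_d\subseteq\mathbb{R}^{d\times d}$ is the set of all $G$-matrices of value $1$; it is a bounded convex polyhedron. For $i=1,\dots,d$, $R_i\in\mathbb{R}^{d\times d}$ (respectively $C_i\in\mathbb{R}^{d\times d}$) is the matrix whose entries in the $i$th row (respectively $i$th column) are all $1$ and whose remaining entries are $0$. The vertices of a polytope $\mathcal{P}$ are the elements of the unique inclusion-minimal finite set $S$ with $\mathcal{P}=\operatorname{conv}(S)$ (equivalently, its extreme points). -}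

module Defs where

open import Algebra.Bundles.Raw using (RawMonoid)
import Algebra.Definitions.RawMonoid as RawMonoidDefinitions
open import Data.Bool.Base using (if_then_else_)
open import Data.Fin.Base using (Fin)
open import Data.Fin.Permutation using (Permutation′; _⟨$⟩ʳ_)
import Data.Fin.Properties as Fin
open import Data.Nat.Base as ℕ using (ℕ)
import Data.Nat.Properties as ℕ
open import Data.Product.Base using (Σ-syntax; ∃-syntax; _×_; _,_)
open import Data.Rational.Base as ℚ using (ℚ; 0ℚ; ½; Positive)
import Data.Rational.Properties as ℚ
open import Data.Rational.Solver using (module +-*-Solver)
open import Data.Vec.Functional using (Vector)
open import Level using (0ℓ)
open import Relation.Binary.PropositionalEquality using (_≡_; refl; cong; cong₂; sym; trans)
open import Relation.Nullary.Decidable.Core using (⌊_⌋)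
open import Relation.Unary using (Pred; _∈_; _⊆_; _≐_)

------------------------------------------------------------------------
-- Real numbers

Eventually : Pred ℕ 0ℓ → Set
Eventually P = ∃[ N ] (∀ n → N ℕ.≤ n → P n)

-- A real number is a Cauchy sequence of rationals together with a modulus
-- of convergence; equality of reals is the setoid equality _≈_ below.

IsCauchy : (ℕ → ℚ) → Set
IsCauchy x = ∀ (ε : ℚ) .{{_ : Positive ε}} →
  ∃[ N ] (∀ m n → N ℕ.≤ m → N ℕ.≤ n → ℚ.∣ x m ℚ.- x n ∣ ℚ.≤ ε)

record ℝ : Set where
  constructor mkℝ
  field
    seq    : ℕ → ℚ
    cauchy : IsCauchy seq

open ℝ public

infix 4 _≈_ _≤_

_≈_ : ℝ → ℝ → Set
x ≈ y = ∀ (ε : ℚ) .{{_ : Positive ε}} →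
  Eventually (λ n → ℚ.∣ seq x n ℚ.- seq y n ∣ ℚ.≤ ε)

_≤_ : ℝ → ℝ → Set
x ≤ y = ∀ (ε : ℚ) .{{_ : Positive ε}} →
  Eventually (λ n → seq x n ℚ.≤ seq y n ℚ.+ ε)

fromℚ : ℚ → ℝ
fromℚ p = mkℝ (λ _ → p) λ ε → 0 , λ _ _ _ _ → ℚ.≤-trans
  (ℚ.≤-reflexive (cong ℚ.∣_∣ (ℚ.+-inverseʳ p)))
  (ℚ.<⇒≤ (ℚ.positive⁻¹ ε))

0ℝ 1ℝ : ℝ
0ℝ = fromℚ 0ℚ
1ℝ = fromℚ ℚ.1ℚ

halves : ∀ ε → ½ ℚ.* ε ℚ.+ ½ ℚ.* ε ≡ ε
halves ε = trans (sym (ℚ.*-distribʳ-+ ε ½ ½)) (ℚ.*-identityˡ ε)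

half-pos : ∀ ε .{{_ : Positive ε}} → Positive (½ ℚ.* ε)
half-pos ε = ℚ.pos*pos⇒pos ½ ε

abstract
  +-cauchy : ∀ {x y} → IsCauchy x → IsCauchy y → IsCauchy (λ n → x n ℚ.+ y n)
  +-cauchy {x} {y} cx cy ε =
    let instance _ = half-pos ε
        M , f = cx (½ ℚ.* ε)
        N , g = cy (½ ℚ.* ε)
        open ℚ.≤-Reasoning
    in M ℕ.⊔ N , λ m n p q → begin
      ℚ.∣ (x m ℚ.+ y m) ℚ.- (x n ℚ.+ y n) ∣
        ≡⟨ cong ℚ.∣_∣ (rearrange (x m) (y m) (x n) (y n)) ⟩
      ℚ.∣ (x m ℚ.- x n) ℚ.+ (y m ℚ.- y n) ∣
        ≤⟨ ℚ.∣p+q∣≤∣p∣+∣q∣ (x m ℚ.- x n) (y m ℚ.- y n) ⟩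
      ℚ.∣ x m ℚ.- x n ∣ ℚ.+ ℚ.∣ y m ℚ.- y n ∣
        ≤⟨ ℚ.+-mono-≤ (f m n (ℕ.m⊔n≤o⇒m≤o M N p) (ℕ.m⊔n≤o⇒m≤o M N q))
                      (g m n (ℕ.m⊔n≤o⇒n≤o M N p) (ℕ.m⊔n≤o⇒n≤o M N q)) ⟩
      ½ ℚ.* ε ℚ.+ ½ ℚ.* ε
        ≡⟨ halves ε ⟩
      ε ∎
    where
    rearrange : ∀ a b c d → (a ℚ.+ b) ℚ.- (c ℚ.+ d) ≡ (a ℚ.- c) ℚ.+ (b ℚ.- d)
    rearrange = solve 4 (λ a b c d → (a :+ b) :- (c :+ d) := (a :- c) :+ (b :- d)) refl
      where open +-*-Solver

eventually-bounded : ∀ {x} → IsCauchy x →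
  Σ[ B ∈ ℚ ] Positive B × Eventually (λ n → ℚ.∣ x n ∣ ℚ.≤ B)
eventually-bounded {x} cx =
  let N , f = cx ℚ.1ℚ
      open ℚ.≤-Reasoning
  in ℚ.1ℚ ℚ.+ ℚ.∣ x N ∣
   , ℚ.pos+nonNeg⇒pos ℚ.1ℚ ℚ.∣ x N ∣ {{ℚ.∣-∣-nonNeg (x N)}}
   , N , λ n N≤n → begin
    ℚ.∣ x n ∣                             ≡⟨ cong ℚ.∣_∣ (split (x n) (x N)) ⟩
    ℚ.∣ (x n ℚ.- x N) ℚ.+ x N ∣           ≤⟨ ℚ.∣p+q∣≤∣p∣+∣q∣ (x n ℚ.- x N) (x N) ⟩
    ℚ.∣ x n ℚ.- x N ∣ ℚ.+ ℚ.∣ x N ∣       ≤⟨ ℚ.+-monoˡ-≤ ℚ.∣ x N ∣ (f n N N≤n ℕ.≤-refl) ⟩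
    ℚ.1ℚ ℚ.+ ℚ.∣ x N ∣                    ∎
  where
  split : ∀ a b → a ≡ (a ℚ.- b) ℚ.+ b
  split = solve 2 (λ a b → a := (a :- b) :+ b) refl
    where open +-*-Solver

*-mono-∣∣ : ∀ p q {B C} .{{_ : Positive B}} →
  ℚ.∣ p ∣ ℚ.≤ B → ℚ.∣ q ∣ ℚ.≤ C → ℚ.∣ p ℚ.* q ∣ ℚ.≤ B ℚ.* C
*-mono-∣∣ p q {B} {C} p≤B q≤C = begin
  ℚ.∣ p ℚ.* q ∣           ≡⟨ ℚ.∣p*q∣≡∣p∣*∣q∣ p q ⟩
  ℚ.∣ p ∣ ℚ.* ℚ.∣ q ∣     ≤⟨ ℚ.*-monoʳ-≤-nonNeg ℚ.∣ q ∣ {{ℚ.∣-∣-nonNeg q}} p≤B ⟩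
  B ℚ.* ℚ.∣ q ∣           ≤⟨ ℚ.*-monoˡ-≤-nonNeg B {{ℚ.pos⇒nonNeg B}} q≤C ⟩
  B ℚ.* C                 ∎
  where open ℚ.≤-Reasoning

scaled : ∀ (B ε : ℚ) .{{_ : Positive B}} .{{_ : Positive ε}} →
  Σ[ δ ∈ ℚ ] Positive δ × B ℚ.* δ ≡ ε
scaled B ε =
  let instance _ = ℚ.pos⇒nonZero B
               _ = ℚ.1/pos⇒pos B
  in ℚ.1/ B ℚ.* ε , ℚ.pos*pos⇒pos (ℚ.1/ B) ε
   , trans (sym (ℚ.*-assoc B (ℚ.1/ B) ε))
           (trans (cong (ℚ._* ε) (ℚ.*-inverseʳ B)) (ℚ.*-identityˡ ε))

*-close : ∀ (a b c d : ℚ) {B C δ η ε} .{{_ : Positive B}} .{{_ : Positive C}} →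
  B ℚ.* δ ≡ ½ ℚ.* ε → C ℚ.* η ≡ ½ ℚ.* ε →
  ℚ.∣ a ∣ ℚ.≤ B → ℚ.∣ d ∣ ℚ.≤ C →
  ℚ.∣ a ℚ.- c ∣ ℚ.≤ η → ℚ.∣ b ℚ.- d ∣ ℚ.≤ δ →
  ℚ.∣ a ℚ.* b ℚ.- c ℚ.* d ∣ ℚ.≤ ε
*-close a b c d {B} {C} {δ} {η} {ε} Bδ≡ Cη≡ a≤B d≤C a-c≤η b-d≤δ = begin
  ℚ.∣ a ℚ.* b ℚ.- c ℚ.* d ∣
    ≡⟨ cong ℚ.∣_∣ (rearrange a b c d) ⟩
  ℚ.∣ a ℚ.* (b ℚ.- d) ℚ.+ d ℚ.* (a ℚ.- c) ∣
    ≤⟨ ℚ.∣p+q∣≤∣p∣+∣q∣ (a ℚ.* (b ℚ.- d)) (d ℚ.* (a ℚ.- c)) ⟩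
  ℚ.∣ a ℚ.* (b ℚ.- d) ∣ ℚ.+ ℚ.∣ d ℚ.* (a ℚ.- c) ∣
    ≤⟨ ℚ.+-mono-≤ (*-mono-∣∣ a (b ℚ.- d) a≤B b-d≤δ)
                  (*-mono-∣∣ d (a ℚ.- c) d≤C a-c≤η) ⟩
  B ℚ.* δ ℚ.+ C ℚ.* η
    ≡⟨ cong₂ ℚ._+_ Bδ≡ Cη≡ ⟩
  ½ ℚ.* ε ℚ.+ ½ ℚ.* ε
    ≡⟨ halves ε ⟩
  ε ∎
  where
  open ℚ.≤-Reasoning
  rearrange : ∀ a b c d →
    a ℚ.* b ℚ.- c ℚ.* d ≡ a ℚ.* (b ℚ.- d) ℚ.+ d ℚ.* (a ℚ.- c)
  rearrange = solve 4 (λ a b c d →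
    a :* b :- c :* d := a :* (b :- d) :+ d :* (a :- c)) refl
    where open +-*-Solver

abstract
  *-cauchy : ∀ {x y} → IsCauchy x → IsCauchy y → IsCauchy (λ n → x n ℚ.* y n)
  *-cauchy {x} {y} cx cy ε =
    let B , B>0 , K , x≤B = eventually-bounded cx
        C , C>0 , L , y≤C = eventually-bounded cy
        δ , δ>0 , Bδ≡     = scaled B (½ ℚ.* ε) {{B>0}} {{half-pos ε}}
        η , η>0 , Cη≡     = scaled C (½ ℚ.* ε) {{C>0}} {{half-pos ε}}
        M , f             = cx η {{η>0}}
        N , g             = cy δ {{δ>0}}
        K⊔L = K ℕ.⊔ L
        M⊔N = M ℕ.⊔ N
    in K⊔L ℕ.⊔ M⊔N , λ m n p q →
      let p₁ = ℕ.m⊔n≤o⇒m≤o K⊔L M⊔N p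
          p₂ = ℕ.m⊔n≤o⇒n≤o K⊔L M⊔N p
          q₁ = ℕ.m⊔n≤o⇒m≤o K⊔L M⊔N q
          q₂ = ℕ.m⊔n≤o⇒n≤o K⊔L M⊔N q
      in *-close (x m) (y m) (x n) (y n) {{B>0}} {{C>0}} Bδ≡ Cη≡
           (x≤B m (ℕ.m⊔n≤o⇒m≤o K L p₁)) (y≤C n (ℕ.m⊔n≤o⇒n≤o K L q₁))
           (f m n (ℕ.m⊔n≤o⇒m≤o M N p₂) (ℕ.m⊔n≤o⇒m≤o M N q₂))
           (g m n (ℕ.m⊔n≤o⇒n≤o M N p₂) (ℕ.m⊔n≤o⇒n≤o M N q₂))

infixl 6 _+_
infixl 7 _*_

_+_ : ℝ → ℝ → ℝ
x + y = mkℝ (λ n → seq x n ℚ.+ seq y n)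
            (+-cauchy {seq x} {seq y} (cauchy x) (cauchy y))

_*_ : ℝ → ℝ → ℝ
x * y = mkℝ (λ n → seq x n ℚ.* seq y n)
            (*-cauchy {seq x} {seq y} (cauchy x) (cauchy y))

+-0-rawMonoid : RawMonoid 0ℓ 0ℓ
+-0-rawMonoid = record { Carrier = ℝ ; _≈_ = _≈_ ; _∙_ = _+_ ; ε = 0ℝ }

open RawMonoidDefinitions +-0-rawMonoid public using (sum)

------------------------------------------------------------------------
-- Matrices, convex hulls and vertices

Matrix : ℕ → Set
Matrix d = Fin d → Fin d → ℝ

infix 4 _≈ᴹ_

_≈ᴹ_ : ∀ {d} → Matrix d → Matrix d → Set
A ≈ᴹ B = ∀ i j → A i j ≈ B i j

-- Finite sets of matrices are presented as finite families, possibly with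
-- repetitions; only the set of members, up to _≈ᴹ_, matters.

members : ∀ {d n} → Vector (Matrix d) n → Pred (Matrix d) 0ℓ
members S A = ∃[ k ] A ≈ᴹ S k

conv : ∀ {d n} → Vector (Matrix d) n → Pred (Matrix d) 0ℓ
conv {n = n} S A = Σ[ t ∈ Vector ℝ n ]
  (∀ k → 0ℝ ≤ t k) ×
  sum t ≈ 1ℝ ×
  (∀ i j → A i j ≈ sum (λ k → t k * S k i j))

IsMinimalGenerating : ∀ {d n} → Pred (Matrix d) 0ℓ → Vector (Matrix d) n → Set
IsMinimalGenerating {d} P S =
  P ≐ conv S ×
  (∀ {m} (T : Vector (Matrix d) m) →
    members T ⊆ members S → P ≐ conv T → members S ⊆ members T)

IsVertexSet : ∀ {d n} → Pred (Matrix d) 0ℓ → Vector (Matrix d) n → Set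
IsVertexSet {d} P S =
  IsMinimalGenerating P S ×
  (∀ {m} (T : Vector (Matrix d) m) →
    IsMinimalGenerating P T → members T ≐ members S)

IsVertex : ∀ {d} → Pred (Matrix d) 0ℓ → Pred (Matrix d) 0ℓ
IsVertex {d} P A = ∃[ n ] Σ[ S ∈ Vector (Matrix d) n ]
  IsVertexSet P S × A ∈ members S

------------------------------------------------------------------------
-- The Gardner polytope

IsGMatrix : ∀ {d} → ℝ → Pred (Matrix d) 0ℓ
IsGMatrix {d} N A =
  0ℝ ≤ N ×
  (∀ i j → 0ℝ ≤ A i j) ×
  (∀ (σ : Permutation′ d) → sum (λ i → A i (σ ⟨$⟩ʳ i)) ≈ N)

Gardner : ∀ d → Pred (Matrix d) 0ℓ
Gardner d = IsGMatrix 1ℝ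

R C : ∀ {d} → Fin d → Matrix d
R i k l = if ⌊ k Fin.≟ i ⌋ then 1ℝ else 0ℝ
C i k l = if ⌊ l Fin.≟ i ⌋ then 1ℝ else 0ℝ

{-# OPTIONS --safe #-}
module Submission where

-- Comparing a permutation with its composite with a transposition gives
-- A i j + A k l = A i l + A k j, so A i j = r i + c j with r and c nonnegative: take
-- c j = A 0 j − μ and r i = A i 0 + μ − A 0 0, where μ is the minimum of row 0.  Hence the
-- polytope is the convex hull of the row and column matrices.  Conversely, let M be one of
-- these and M = Σ t k * T k with every T k in the polytope.  The weights sum to 1, so some
-- t k is strictly positive; that T k vanishes wherever M does, and since M has a single
-- entry 1 on every transversal, the transversal sums of T k force T k = M.  So every finite
-- family generating the polytope contains all row and column matrices, which gives both
-- minimality and uniqueness.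

open import Defs
open import Algebra.Bundles using (AbelianGroup)
import Algebra.Properties.CommutativeMonoid.Sum as CommutativeMonoidSum
import Algebra.Properties.Group as GroupProperties
import Algebra.Solver.CommutativeMonoid as CommutativeMonoidSolver
open import Algebra.Structures using (IsAbelianGroup)
open import Data.Bool.Base using (if_then_else_)
open import Data.Fin.Base using (Fin; zero; suc; _↑ˡ_; _↑ʳ_; splitAt; punchIn; punchOut)
open import Data.Fin.Permutation as Perm using (Permutation′; _⟨$⟩ʳ_; _⟨$⟩ˡ_; _∘ₚ_)
import Data.Fin.Properties as Fin
open import Data.Nat.Base as ℕ using (ℕ; zero; suc; _≥_)
import Data.Nat.Properties as ℕ
open import Data.Product.Base using (∃-syntax; Σ-syntax; _×_; _,_; proj₁; proj₂; uncurry)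
open import Data.Rational.Base as ℚ using (ℚ; 0ℚ; 1ℚ; ½; Positive)
import Data.Rational.Properties as ℚ
open import Data.Rational.Solver using (module +-*-Solver)
open import Data.Sum.Base as Sum using (_⊎_; inj₁; inj₂; [_,_]′)
open import Data.Vec.Functional using (Vector; removeAt; _++_)
open import Data.Vec.Functional.Properties using (lookup-++ˡ; lookup-++ʳ)
open import Function.Base using (_∘_)
open import Function.Bundles using (_⇔_; mk⇔; Injection)
open import Function.Properties.Inverse using (↔⇒↣)
open import Level using (0ℓ)
open import Relation.Binary.PropositionalEquality
  using (_≡_; _≢_; refl; sym; trans; cong; cong₂; subst; module ≡-Reasoning)
import Relation.Binary.Reasoning.Setoid as SetoidReasoning
open import Relation.Nullary using (¬_; yes; no; contradiction)
open import Relation.Nullary.Decidable.Core using (⌊_⌋)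
open import Relation.Unary using (Pred; _∈_; _⊆_; _≐_)

private
  variable
    d n : ℕ
    ε : ℚ
    x y z u v : ℝ
    P Q : Pred ℕ 0ℓ

-- Rational arithmetic

p≤∣p∣ : ∀ p → p ℚ.≤ ℚ.∣ p ∣
p≤∣p∣ p with ℚ.≤-total 0ℚ p
... | inj₁ 0≤p = ℚ.≤-reflexive (sym (ℚ.0≤p⇒∣p∣≡p 0≤p))
... | inj₂ p≤0 = ℚ.≤-trans p≤0 (ℚ.0≤∣p∣ p)

p≤p+ε : ∀ p ε .{{_ : Positive ε}} → p ℚ.≤ p ℚ.+ ε
p≤p+ε p ε = ℚ.≤-trans (ℚ.≤-reflexive (sym (ℚ.+-identityʳ p)))
  (ℚ.+-monoʳ-≤ p (ℚ.<⇒≤ (ℚ.positive⁻¹ ε)))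

p-q≤r⇒p≤q+r : ∀ p q r → p ℚ.- q ℚ.≤ r → p ℚ.≤ q ℚ.+ r
p-q≤r⇒p≤q+r p q r p-q≤r = begin
  p                  ≡⟨ solve 2 (λ p q → p := q :+ (p :- q)) refl p q ⟩
  q ℚ.+ (p ℚ.- q)    ≤⟨ ℚ.+-monoʳ-≤ q p-q≤r ⟩
  q ℚ.+ r            ∎
  where open ℚ.≤-Reasoning; open +-*-Solver

p≤q+r⇒p-q≤r : ∀ p q r → p ℚ.≤ q ℚ.+ r → p ℚ.- q ℚ.≤ r
p≤q+r⇒p-q≤r p q r p≤q+r = begin
  p ℚ.- q            ≤⟨ ℚ.+-monoˡ-≤ (ℚ.- q) p≤q+r ⟩
  (q ℚ.+ r) ℚ.- q    ≡⟨ solve 2 (λ q r → (q :+ r) :- q := r) refl q r ⟩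
  r                  ∎
  where open ℚ.≤-Reasoning; open +-*-Solver

neg-minus : ∀ p q → ℚ.- (p ℚ.- q) ≡ q ℚ.- p
neg-minus = solve 2 (λ p q → :- (p :- q) := q :- p) refl
  where open +-*-Solver

∣p-q∣≤ε⇒p≤q+ε : ∀ p q → ℚ.∣ p ℚ.- q ∣ ℚ.≤ ε → p ℚ.≤ q ℚ.+ ε
∣p-q∣≤ε⇒p≤q+ε p q le = p-q≤r⇒p≤q+r p q _ (ℚ.≤-trans (p≤∣p∣ (p ℚ.- q)) le)

∣p-q∣≤ε⇒q≤p+ε : ∀ p q → ℚ.∣ p ℚ.- q ∣ ℚ.≤ ε → q ℚ.≤ p ℚ.+ ε
∣p-q∣≤ε⇒q≤p+ε p q le = ∣p-q∣≤ε⇒p≤q+ε q p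
  (subst (ℚ._≤ _) (trans (sym (ℚ.∣-p∣≡∣p∣ (p ℚ.- q))) (cong ℚ.∣_∣ (neg-minus p q))) le)

p≤q+ε∧q≤p+ε⇒∣p-q∣≤ε : ∀ p q → p ℚ.≤ q ℚ.+ ε → q ℚ.≤ p ℚ.+ ε → ℚ.∣ p ℚ.- q ∣ ℚ.≤ ε
p≤q+ε∧q≤p+ε⇒∣p-q∣≤ε p q p≤ q≤ with ℚ.∣p∣≡p∨∣p∣≡-p (p ℚ.- q)
... | inj₁ eq = ℚ.≤-trans (ℚ.≤-reflexive eq) (p≤q+r⇒p-q≤r p q _ p≤)
... | inj₂ eq = ℚ.≤-trans (ℚ.≤-reflexive (trans eq (neg-minus p q))) (p≤q+r⇒p-q≤r q p _ q≤)

-- Adding `ε` is monotone, hence distributes over `⊓`. Minima therefore inherit error bounds without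
-- loss.
⊓-mono-+ε : ∀ a b c e → a ℚ.≤ c ℚ.+ ε → b ℚ.≤ e ℚ.+ ε → a ℚ.⊓ b ℚ.≤ (c ℚ.⊓ e) ℚ.+ ε
⊓-mono-+ε {ε} a b c e a≤ b≤ = ℚ.≤-trans (ℚ.⊓-mono-≤ a≤ b≤)
  (ℚ.≤-reflexive (sym (ℚ.mono-≤-distrib-⊓ (ℚ.+-monoˡ-≤ ε) c e)))

-- Used to keep half of a lower bound `δ` when an approximation, or the other summand, takes away at
-- most the other half.
½δ≤p : ∀ p δ → δ ℚ.≤ p ℚ.+ ½ ℚ.* δ → ½ ℚ.* δ ℚ.≤ p
½δ≤p p δ δ≤p+½δ = begin
  ½ ℚ.* δ                              ≡⟨ solve 1 (λ h → h := h :+ h :- h) refl (½ ℚ.* δ) ⟩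
  (½ ℚ.* δ ℚ.+ ½ ℚ.* δ) ℚ.- ½ ℚ.* δ    ≡⟨ cong (ℚ._- ½ ℚ.* δ) (halves δ) ⟩
  δ ℚ.- ½ ℚ.* δ                        ≤⟨ ℚ.+-monoˡ-≤ (ℚ.- (½ ℚ.* δ)) δ≤p+½δ ⟩
  (p ℚ.+ ½ ℚ.* δ) ℚ.- ½ ℚ.* δ          ≡⟨ solve 2 (λ p h → p :+ h :- h := p) refl p (½ ℚ.* δ) ⟩
  p                                    ∎
  where open ℚ.≤-Reasoning; open +-*-Solver

-- For 0 ≤ q: p q ≥ − η q ≥ − η B.
0≤p*q+ε : ∀ p q {η B} .{{_ : Positive η}} → 0ℚ ℚ.≤ p ℚ.+ η → 0ℚ ℚ.≤ q → q ℚ.≤ B →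
  η ℚ.* B ≡ ε → 0ℚ ℚ.≤ p ℚ.* q ℚ.+ ε
0≤p*q+ε {ε} p q {η} {B} 0≤p+η 0≤q q≤B ηB≡ε = begin
  0ℚ                       ≡⟨ ℚ.*-zeroˡ q ⟨
  0ℚ ℚ.* q                 ≤⟨ ℚ.*-monoʳ-≤-nonNeg q {{ℚ.nonNegative 0≤q}} 0≤p+η ⟩
  (p ℚ.+ η) ℚ.* q          ≡⟨ ℚ.*-distribʳ-+ q p η ⟩
  p ℚ.* q ℚ.+ η ℚ.* q      ≤⟨ ℚ.+-monoʳ-≤ (p ℚ.* q) (ℚ.*-monoˡ-≤-nonNeg η {{ℚ.pos⇒nonNeg η}} q≤B) ⟩
  p ℚ.* q ℚ.+ η ℚ.* B      ≡⟨ cong (p ℚ.* q ℚ.+_) ηB≡ε ⟩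
  p ℚ.* q ℚ.+ ε            ∎
  where open ℚ.≤-Reasoning

-- Order and addition of reals

-- x ≈ y and x ≤ y unfold to functions from which x and y cannot be inferred;
-- the record types keep them visible.

infix 4 _≃_ _≼_

record _≃_ (x y : ℝ) : Set where
  constructor wrap
  field unwrap : x ≈ y

record _≼_ (x y : ℝ) : Set where
  constructor wrap
  field unwrap : x ≤ y

open _≃_ using () renaming (unwrap to unwrap-≃)
open _≼_ using () renaming (unwrap to unwrap-≼)

both : Eventually P → Eventually Q → Eventually (λ n → P n × Q n)
both (M , f) (N , g) = M ℕ.⊔ N , λ n le →
  f n (ℕ.m⊔n≤o⇒m≤o M N le) , g n (ℕ.m⊔n≤o⇒n≤o M N le)

eventually-map : (∀ n → P n → Q n) → Eventually P → Eventually Q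
eventually-map h (N , f) = N , λ n le → h n (f n le)

≃⇒≼ : x ≃ y → x ≼ y
≃⇒≼ {x} {y} (wrap x≈y) = wrap λ ε →
  eventually-map (λ n → ∣p-q∣≤ε⇒p≤q+ε (seq x n) (seq y n)) (x≈y ε)

≃⇒≽ : x ≃ y → y ≼ x
≃⇒≽ {x} {y} (wrap x≈y) = wrap λ ε →
  eventually-map (λ n → ∣p-q∣≤ε⇒q≤p+ε (seq x n) (seq y n)) (x≈y ε)

-- Transitivity and additive congruence of `_≃_` below reduce through this to `_≼_`, so that `ε` is
-- halved only for the order.
≼-antisym : x ≼ y → y ≼ x → x ≃ y
≼-antisym {x} {y} (wrap x≤y) (wrap y≤x) = wrap λ ε → eventually-map
  (λ n → uncurry (p≤q+ε∧q≤p+ε⇒∣p-q∣≤ε (seq x n) (seq y n))) (both (x≤y ε) (y≤x ε))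

pointwise-≼ : (∀ n → seq x n ℚ.≤ seq y n) → x ≼ y
pointwise-≼ x≤y = wrap λ ε → 0 , λ n _ → ℚ.≤-trans (x≤y n) (p≤p+ε _ ε)

pointwise-≃ : (∀ n → seq x n ≡ seq y n) → x ≃ y
pointwise-≃ x≡y = ≼-antisym
  (pointwise-≼ (λ n → ℚ.≤-reflexive (x≡y n)))
  (pointwise-≼ (λ n → ℚ.≤-reflexive (sym (x≡y n))))

≼-trans : x ≼ y → y ≼ z → x ≼ z
≼-trans {x} {y} {z} (wrap x≤y) (wrap y≤z) = wrap λ ε →
  let instance _ = half-pos ε
      open ℚ.≤-Reasoning
  in eventually-map
    (λ n (a , b) → begin
      seq x n                              ≤⟨ a ⟩
      seq y n ℚ.+ ½ ℚ.* ε                  ≤⟨ ℚ.+-monoˡ-≤ (½ ℚ.* ε) b ⟩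
      (seq z n ℚ.+ ½ ℚ.* ε) ℚ.+ ½ ℚ.* ε    ≡⟨ ℚ.+-assoc (seq z n) _ _ ⟩
      seq z n ℚ.+ (½ ℚ.* ε ℚ.+ ½ ℚ.* ε)    ≡⟨ cong (seq z n ℚ.+_) (halves ε) ⟩
      seq z n ℚ.+ ε                        ∎)
    (both (x≤y (½ ℚ.* ε)) (y≤z (½ ℚ.* ε)))

+-mono-≼ : x ≼ y → u ≼ v → x + u ≼ y + v
+-mono-≼ {x} {y} {u} {v} (wrap x≤y) (wrap u≤v) = wrap λ ε →
  let instance _ = half-pos ε
      open ℚ.≤-Reasoning
      open +-*-Solver
  in eventually-map
    (λ n (a , b) → begin
      seq x n ℚ.+ seq u n
        ≤⟨ ℚ.+-mono-≤ a b ⟩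
      (seq y n ℚ.+ ½ ℚ.* ε) ℚ.+ (seq v n ℚ.+ ½ ℚ.* ε)
        ≡⟨ solve 3 (λ a b e → (a :+ e) :+ (b :+ e) := (a :+ b) :+ (e :+ e)) refl
             (seq y n) (seq v n) (½ ℚ.* ε) ⟩
      (seq y n ℚ.+ seq v n) ℚ.+ (½ ℚ.* ε ℚ.+ ½ ℚ.* ε)
        ≡⟨ cong (seq y n ℚ.+ seq v n ℚ.+_) (halves ε) ⟩
      (seq y n ℚ.+ seq v n) ℚ.+ ε ∎)
    (both (x≤y (½ ℚ.* ε)) (u≤v (½ ℚ.* ε)))

≃-refl : x ≃ x
≃-refl = pointwise-≃ (λ _ → refl)

≃-reflexive : x ≡ y → x ≃ y
≃-reflexive refl = ≃-refl

≼-refl : x ≼ x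
≼-refl = ≃⇒≼ ≃-refl

≃-sym : x ≃ y → y ≃ x
≃-sym x≃y = ≼-antisym (≃⇒≽ x≃y) (≃⇒≼ x≃y)

≃-trans : x ≃ y → y ≃ z → x ≃ z
≃-trans x≃y y≃z = ≼-antisym
  (≼-trans (≃⇒≼ x≃y) (≃⇒≼ y≃z)) (≼-trans (≃⇒≽ y≃z) (≃⇒≽ x≃y))

+-cong : x ≃ y → u ≃ v → x + u ≃ y + v
+-cong x≃y u≃v = ≼-antisym
  (+-mono-≼ (≃⇒≼ x≃y) (≃⇒≼ u≃v)) (+-mono-≼ (≃⇒≽ x≃y) (≃⇒≽ u≃v))

≼-respʳ : y ≃ z → x ≼ y → x ≼ z
≼-respʳ y≃z x≼y = ≼-trans x≼y (≃⇒≼ y≃z)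

≼-respˡ : x ≃ z → x ≼ y → z ≼ y
≼-respˡ x≃z x≼y = ≼-trans (≃⇒≽ x≃z) x≼y

infix 8 -_

-- Written as a product so that the Cauchy condition comes with `_*_`.
-_ : ℝ → ℝ
- x = fromℚ (ℚ.- 1ℚ) * x

neg-cong : x ≃ y → - x ≃ - y
neg-cong {x} {y} (wrap x≈y) = wrap λ ε → eventually-map
  (λ n → ℚ.≤-trans (ℚ.≤-reflexive (begin
    ℚ.∣ ℚ.- 1ℚ ℚ.* seq x n ℚ.- ℚ.- 1ℚ ℚ.* seq y n ∣
      ≡⟨ cong ℚ.∣_∣ (solve 2 (λ a b → con (ℚ.- 1ℚ) :* a :- con (ℚ.- 1ℚ) :* b := :- (a :- b)) refl
           (seq x n) (seq y n)) ⟩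
    ℚ.∣ ℚ.- (seq x n ℚ.- seq y n) ∣
      ≡⟨ ℚ.∣-p∣≡∣p∣ (seq x n ℚ.- seq y n) ⟩
    ℚ.∣ seq x n ℚ.- seq y n ∣ ∎)))
  (x≈y ε)
  where
  open ≡-Reasoning
  open +-*-Solver

+-0-isAbelianGroup : IsAbelianGroup _≃_ _+_ 0ℝ -_
+-0-isAbelianGroup = record
  { isGroup = record
    { isMonoid = record
      { isSemigroup = record
        { isMagma = record
          { isEquivalence = record { refl = ≃-refl ; sym = ≃-sym ; trans = ≃-trans }
          ; ∙-cong = +-cong
          }
        ; assoc = λ x y z → pointwise-≃ (λ n → ℚ.+-assoc (seq x n) (seq y n) (seq z n))
        }
      ; identity = (λ x → pointwise-≃ (λ n → ℚ.+-identityˡ (seq x n)))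
                 , (λ x → pointwise-≃ (λ n → ℚ.+-identityʳ (seq x n)))
      }
    ; inverse = (λ x → pointwise-≃ (λ n →
                  solve 1 (λ a → con (ℚ.- 1ℚ) :* a :+ a := con 0ℚ) refl (seq x n)))
              , (λ x → pointwise-≃ (λ n →
                  solve 1 (λ a → a :+ con (ℚ.- 1ℚ) :* a := con 0ℚ) refl (seq x n)))
    ; ⁻¹-cong = neg-cong
    }
  ; comm = λ x y → pointwise-≃ (λ n → ℚ.+-comm (seq x n) (seq y n))
  }
  where open +-*-Solver

-- General results on sums apply over this group to the given `sum`, which is built from `_+_` and
-- `0ℝ` alone, whatever the equality.
+-0-abelianGroup : AbelianGroup 0ℓ 0ℓ
+-0-abelianGroup = record { isAbelianGroup = +-0-isAbelianGroup }

open AbelianGroup +-0-abelianGroup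
  using (setoid; group)
  renaming (commutativeMonoid to +-0-commutativeMonoid; ∙-congˡ to +-congˡ; ∙-congʳ to +-congʳ;
            identityˡ to +-identityˡ; identityʳ to +-identityʳ; comm to +-comm; assoc to +-assoc;
            inverseʳ to +-inverseʳ)

open CommutativeMonoidSum +-0-commutativeMonoid
  using (sum-remove; sum-cong-≋; ∑-distrib-+; ∑-comm; sum-replicate-zero)

module ≃-Reasoning = SetoidReasoning setoid

open GroupProperties group
  using () renaming (∙-cancelʳ to +-cancelʳ; //-rightDividesʳ to [x+z]-z≃x)

-- Multiplication

*-identityˡ : ∀ x → 1ℝ * x ≃ x
*-identityˡ x = pointwise-≃ (λ n → ℚ.*-identityˡ (seq x n))

*-identityʳ : ∀ x → x * 1ℝ ≃ x
*-identityʳ x = pointwise-≃ (λ n → ℚ.*-identityʳ (seq x n))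

*-zeroˡ : ∀ x → 0ℝ * x ≃ 0ℝ
*-zeroˡ x = pointwise-≃ (λ n → ℚ.*-zeroˡ (seq x n))

*-zeroʳ : ∀ x → x * 0ℝ ≃ 0ℝ
*-zeroʳ x = pointwise-≃ (λ n → ℚ.*-zeroʳ (seq x n))

0≼1 : 0ℝ ≼ 1ℝ
0≼1 = pointwise-≼ (λ _ → ℚ.<⇒≤ (ℚ.positive⁻¹ 1ℚ))

*-nonNeg : 0ℝ ≼ x → 0ℝ ≼ y → 0ℝ ≼ x * y
*-nonNeg {x} {y} (wrap 0≤x) (wrap 0≤y) = wrap λ ε {{ε>0}} →
  let B , B>0 , x≤B = eventually-bounded (cauchy x)
      D , D>0 , y≤D = eventually-bounded (cauchy y)
      η , η>0 , Bη≡ε = scaled B ε {{B>0}}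
      θ , θ>0 , Dθ≡ε = scaled D ε {{D>0}}
  in eventually-map
    (λ n ((xB , yD) , (0≤xη , 0≤yθ)) → product (seq x n) (seq y n) ε B D η θ
      {{ε>0}} {{η>0}} {{θ>0}} (trans (ℚ.*-comm η B) Bη≡ε) (trans (ℚ.*-comm θ D) Dθ≡ε)
      (ℚ.≤-trans (p≤∣p∣ _) xB) (ℚ.≤-trans (p≤∣p∣ _) yD) 0≤xη 0≤yθ)
    (both (both x≤B y≤D) (both (0≤x θ {{θ>0}}) (0≤y η {{η>0}})))
  where
  product : ∀ p q ε B D η θ .{{_ : Positive ε}} .{{_ : Positive η}} .{{_ : Positive θ}} →
    η ℚ.* B ≡ ε → θ ℚ.* D ≡ ε → p ℚ.≤ B → q ℚ.≤ D →
    0ℚ ℚ.≤ p ℚ.+ θ → 0ℚ ℚ.≤ q ℚ.+ η → 0ℚ ℚ.≤ p ℚ.* q ℚ.+ ε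
  -- Nonnegative reals may have slightly negative terms. Signs of rationals are decidable: a
  -- nonnegative factor, bounded by `B` or `D`, scales the error of the other to at most `ε`, and
  -- two nonpositive factors have a nonnegative product.
  product p q ε B D η θ ηB θD p≤B q≤D 0≤p+θ 0≤q+η with ℚ.≤-total 0ℚ q | ℚ.≤-total 0ℚ p
  ... | inj₁ 0≤q | _        = 0≤p*q+ε p q 0≤p+θ 0≤q q≤D θD
  ... | inj₂ _   | inj₁ 0≤p = subst (λ r → 0ℚ ℚ.≤ r ℚ.+ ε) (ℚ.*-comm q p)
    (0≤p*q+ε q p 0≤q+η 0≤p p≤B ηB)
  ... | inj₂ q≤0 | inj₂ p≤0 = ℚ.≤-trans
    (ℚ.≤-trans (ℚ.≤-reflexive (sym (ℚ.*-zeroˡ q)))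
      (ℚ.*-monoʳ-≤-nonPos q {{ℚ.nonPositive q≤0}} p≤0))
    (p≤p+ε (p ℚ.* q) ε)

-- Strict positivity

-- Carries a rational lower bound valid from some index on: this is what makes division by `x`
-- possible.
record Pos (x : ℝ) : Set where
  constructor wrap
  field unwrap : ∃[ δ ] Positive δ × Eventually (λ n → δ ℚ.≤ seq x n)

Pos-resp-≃ : x ≃ y → Pos x → Pos y
Pos-resp-≃ {x} {y} x≃y (wrap (δ , δ>0 , δ≤x)) = wrap (½ ℚ.* δ , half-pos δ {{δ>0}} , eventually-map
  (λ n (δ≤xₙ , xₙ≤yₙ) → ½δ≤p (seq y n) δ (ℚ.≤-trans δ≤xₙ xₙ≤yₙ))
  (both δ≤x (unwrap-≼ (≃⇒≼ x≃y) (½ ℚ.* δ) {{half-pos δ {{δ>0}}}})))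

Pos-1 : Pos 1ℝ
Pos-1 = wrap (1ℚ , _ , 0 , λ _ _ → ℚ.≤-refl)

¬Pos-0 : ¬ Pos 0ℝ
¬Pos-0 (wrap (δ , δ>0 , N , δ≤0)) =
  ℚ.<-irrefl refl (ℚ.<-≤-trans (ℚ.positive⁻¹ δ {{δ>0}}) (δ≤0 N ℕ.≤-refl))

-- One sufficiently late term decides: beyond the Cauchy index for half of `δ`, all terms stay
-- within that distance of it.
Pos-at : ∀ x δ .{{_ : Positive δ}} →
  ∃[ N ] (∀ k → N ℕ.≤ k → δ ℚ.≤ seq x k → Pos x)
Pos-at x δ =
  let instance _ = half-pos δ
      N , close = cauchy x (½ ℚ.* δ)
  in N , λ k N≤k δ≤xₖ → wrap (½ ℚ.* δ , half-pos δ , N , λ n N≤n →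
    ½δ≤p (seq x n) δ (ℚ.≤-trans δ≤xₖ (∣p-q∣≤ε⇒p≤q+ε (seq x k) (seq x n) (close k n N≤k N≤n))))

-- The order of reals is not decidable, so the choice is made between rationals at a single late
-- index `k`, where one of the two terms is at least half of `δ`.
Pos-+ : Pos (x + y) → Pos x ⊎ Pos y
Pos-+ {x} {y} (wrap (δ , δ>0 , K , δ≤x+y)) =
  let instance _ = δ>0
      M , posx = Pos-at x (½ ℚ.* δ) {{half-pos δ}}
      N , posy = Pos-at y (½ ℚ.* δ) {{half-pos δ}}
      k = K ℕ.⊔ (M ℕ.⊔ N)
      M⊔N≤k = ℕ.m≤n⊔m K (M ℕ.⊔ N)
  in Sum.map (posx k (ℕ.≤-trans (ℕ.m≤m⊔n M N) M⊔N≤k))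
             (posy k (ℕ.≤-trans (ℕ.m≤n⊔m M N) M⊔N≤k))
             (large (seq x k) (seq y k) (δ≤x+y k (ℕ.m≤m⊔n K (M ℕ.⊔ N))))
  where
  large : ∀ p q → δ ℚ.≤ p ℚ.+ q → ½ ℚ.* δ ℚ.≤ p ⊎ ½ ℚ.* δ ℚ.≤ q
  large p q δ≤p+q with ℚ.≤-total (½ ℚ.* δ) p | ℚ.≤-total (½ ℚ.* δ) q
  ... | inj₁ h≤p | _        = inj₁ h≤p
  ... | inj₂ _   | inj₁ h≤q = inj₂ h≤q
  ... | inj₂ _   | inj₂ q≤h = inj₁ (½δ≤p p δ (ℚ.≤-trans δ≤p+q (ℚ.+-monoʳ-≤ p q≤h)))

Pos-sum : (t : Vector ℝ n) → Pos (sum t) → ∃[ k ] Pos (t k)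
Pos-sum {zero}  t pos = contradiction pos ¬Pos-0
Pos-sum {suc n} t pos = [ zero ,_ , (λ pos′ → let k , posₖ = Pos-sum (t ∘ suc) pos′ in suc k , posₖ) ]′
  (Pos-+ pos)

*-cancel-≼0 : Pos x → x * y ≼ 0ℝ → y ≼ 0ℝ
*-cancel-≼0 {x} {y} (wrap (δ , δ>0 , δ≤x)) (wrap xy≤0) = wrap λ ε →
  let instance _ = δ>0
               _ = ℚ.pos*pos⇒pos δ ε
  in eventually-map
    (λ n (δ≤x , xy≤δε) → quotient (seq x n) (seq y n) ε δ≤x xy≤δε)
    -- An error of `δ * ε` in the product becomes `ε` after division by a factor that is at least
    -- `δ`.
    (both δ≤x (xy≤0 (δ ℚ.* ε)))
  where
  open ℚ.≤-Reasoning
  quotient : ∀ p q ε .{{_ : Positive ε}} → δ ℚ.≤ p → p ℚ.* q ℚ.≤ 0ℚ ℚ.+ δ ℚ.* ε → q ℚ.≤ 0ℚ ℚ.+ ε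
  quotient p q ε δ≤p pq≤δε with ℚ.≤-total q 0ℚ
  ... | inj₁ q≤0 = ℚ.≤-trans q≤0 (p≤p+ε 0ℚ ε)
  ... | inj₂ 0≤q = ℚ.≤-trans
    (ℚ.*-cancelˡ-≤-pos δ {{δ>0}} (begin
      δ ℚ.* q              ≤⟨ ℚ.*-monoʳ-≤-nonNeg q {{ℚ.nonNegative 0≤q}} δ≤p ⟩
      p ℚ.* q              ≤⟨ pq≤δε ⟩
      0ℚ ℚ.+ δ ℚ.* ε       ≡⟨ ℚ.+-identityˡ _ ⟩
      δ ℚ.* ε              ∎))
    (ℚ.≤-reflexive (sym (ℚ.+-identityˡ ε)))

-- Minima

abstract
  ⊓-cauchy : ∀ {x y} → IsCauchy x → IsCauchy y → IsCauchy (λ n → x n ℚ.⊓ y n)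
  ⊓-cauchy {x} {y} cx cy ε =
    let M , f = cx ε
        N , g = cy ε
    in M ℕ.⊔ N , λ m n p q →
      let xs = f m n (ℕ.m⊔n≤o⇒m≤o M N p) (ℕ.m⊔n≤o⇒m≤o M N q)
          ys = g m n (ℕ.m⊔n≤o⇒n≤o M N p) (ℕ.m⊔n≤o⇒n≤o M N q)
      in p≤q+ε∧q≤p+ε⇒∣p-q∣≤ε (x m ℚ.⊓ y m) (x n ℚ.⊓ y n)
        (⊓-mono-+ε (x m) (y m) (x n) (y n)
          (∣p-q∣≤ε⇒p≤q+ε (x m) (x n) xs) (∣p-q∣≤ε⇒p≤q+ε (y m) (y n) ys))
        (⊓-mono-+ε (x n) (y n) (x m) (y m)
          (∣p-q∣≤ε⇒q≤p+ε (x m) (x n) xs) (∣p-q∣≤ε⇒q≤p+ε (y m) (y n) ys))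

infixl 7 _⊓_

_⊓_ : ℝ → ℝ → ℝ
x ⊓ y = mkℝ (λ n → seq x n ℚ.⊓ seq y n)
            (⊓-cauchy {seq x} {seq y} (cauchy x) (cauchy y))

⊓-glb : x ≼ y → x ≼ z → x ≼ y ⊓ z
⊓-glb {x} {y} {z} (wrap x≤y) (wrap x≤z) = wrap λ ε → eventually-map
  (λ n (a , b) → subst (ℚ._≤ (seq y n ℚ.⊓ seq z n) ℚ.+ ε) (ℚ.⊓-idem (seq x n))
    (⊓-mono-+ε (seq x n) (seq x n) (seq y n) (seq z n) a b))
  (both (x≤y ε) (x≤z ε))

-- Taken term by term on the sequences, since comparing reals to select an index that attains it is
-- not effective.
minimum : Vector ℝ (suc n) → ℝ
minimum {zero}  t = t zero
minimum {suc n} t = t zero ⊓ minimum (t ∘ suc)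

minimum-≼ : (t : Vector ℝ (suc n)) → ∀ i → minimum t ≼ t i
minimum-≼ {zero}  t zero    = ≼-refl
minimum-≼ {suc n} t zero    = pointwise-≼ (λ k → ℚ.p⊓q≤p (seq (t zero) k) _)
minimum-≼ {suc n} t (suc i) = ≼-trans
  (pointwise-≼ (λ k → ℚ.p⊓q≤q (seq (t zero) k) (seq (minimum (t ∘ suc)) k)))
  (minimum-≼ (t ∘ suc) i)

minimum-glb : (t : Vector ℝ (suc n)) → (∀ i → x ≼ t i) → x ≼ minimum t
minimum-glb {zero}  t x≼t = x≼t zero
minimum-glb {suc n} t x≼t = ⊓-glb (x≼t zero) (minimum-glb (t ∘ suc) (x≼t ∘ suc))

-- Finite sums

sum-cong : {s t : Vector ℝ n} → (∀ i → s i ≃ t i) → sum s ≃ sum t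
sum-cong = sum-cong-≋

sum-zero : {t : Vector ℝ n} → (∀ i → t i ≃ 0ℝ) → sum t ≃ 0ℝ
sum-zero {n} t≃0 = ≃-trans (sum-cong t≃0) (sum-replicate-zero n)

sum-nonNeg : (t : Vector ℝ n) → (∀ i → 0ℝ ≼ t i) → 0ℝ ≼ sum t
sum-nonNeg {zero}  t 0≼t = ≼-refl
sum-nonNeg {suc n} t 0≼t =
  ≼-respˡ (+-identityˡ 0ℝ) (+-mono-≼ (0≼t zero) (sum-nonNeg (t ∘ suc) (0≼t ∘ suc)))

term≼sum : (t : Vector ℝ n) → (∀ i → 0ℝ ≼ t i) → ∀ i → t i ≼ sum t
term≼sum {suc n} t 0≼t i = ≼-respʳ (≃-sym (sum-remove t)) (≼-respˡ (+-identityʳ (t i))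
  (+-mono-≼ ≼-refl (sum-nonNeg (removeAt t i) (0≼t ∘ punchIn i))))

sum-single : (t : Vector ℝ n) (i : Fin n) → (∀ j → j ≢ i → t j ≃ 0ℝ) → sum t ≃ t i
sum-single {suc n} t i t≃0 = begin
  sum t                       ≈⟨ sum-remove t ⟩
  t i + sum (removeAt t i)    ≈⟨ +-congˡ (sum-zero (λ j → t≃0 (punchIn i j) (Fin.punchInᵢ≢i i j))) ⟩
  t i + 0ℝ                    ≈⟨ +-identityʳ (t i) ⟩
  t i                         ∎
  where open ≃-Reasoning

-- Splitting off positions `i` and `k` leaves equal remainders, which cancel.
sum-exchange : (s t : Vector ℝ n) {i k : Fin n} → i ≢ k →
  (∀ j → j ≢ i → j ≢ k → s j ≃ t j) → sum s ≃ sum t → s i + s k ≃ t i + t k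
sum-exchange {suc zero} s t {zero} {zero} i≢k _ _ = contradiction refl i≢k
sum-exchange {suc (suc n)} s t {i} {k} i≢k s≃t ∑s≃∑t = +-cancelʳ (rest t) _ _ (begin
  (s i + s k) + rest t    ≈⟨ +-congˡ (sum-cong agree) ⟨
  (s i + s k) + rest s    ≈⟨ split s ⟨
  sum s                   ≈⟨ ∑s≃∑t ⟩
  sum t                   ≈⟨ split t ⟩
  (t i + t k) + rest t    ∎)
  where
  open ≃-Reasoning
  -- The position of `k` once `i` has been removed.
  k′ = punchOut i≢k

  rest : Vector ℝ (suc (suc n)) → ℝ
  rest r = sum (removeAt (removeAt r i) k′)

  split : ∀ r → sum r ≃ (r i + r k) + rest r
  split r = begin
    sum r                                   ≈⟨ sum-remove r ⟩
    r i + sum (removeAt r i)                ≈⟨ +-congˡ (sum-remove (removeAt r i)) ⟩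
    r i + (r (punchIn i k′) + rest r)       ≡⟨ cong (λ l → r i + (r l + rest r)) (Fin.punchIn-punchOut i≢k) ⟩
    r i + (r k + rest r)                    ≈⟨ +-assoc (r i) (r k) (rest r) ⟨
    (r i + r k) + rest r                    ∎

  agree : ∀ j → removeAt (removeAt s i) k′ j ≃ removeAt (removeAt t i) k′ j
  agree j = s≃t _ (Fin.punchInᵢ≢i i _) λ eq → Fin.punchInᵢ≢i k′ j
    (Fin.punchIn-injective i _ _ (trans eq (sym (Fin.punchIn-punchOut i≢k))))

sum-join : ∀ m (t : Vector ℝ (m ℕ.+ n)) → sum t ≃ sum (λ i → t (i ↑ˡ n)) + sum (λ i → t (m ↑ʳ i))
sum-join zero    t = ≃-sym (+-identityˡ (sum t))
sum-join (suc m) t =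
  ≃-trans (+-congˡ (sum-join m (t ∘ suc))) (≃-sym (+-assoc (t zero) _ _))

-- The decomposition A i j = r i + c j

transposeˡ : ∀ (i j : Fin n) → Perm.transpose i j ⟨$⟩ʳ i ≡ j
transposeˡ i j with i Fin.≟ i
... | yes _  = refl
... | no i≢i = contradiction refl i≢i

transposeʳ : ∀ (i j : Fin n) → Perm.transpose i j ⟨$⟩ʳ j ≡ i
transposeʳ i j with j Fin.≟ i
... | yes j≡i = j≡i
... | no _ with j Fin.≟ j
...   | yes _  = refl
...   | no j≢j = contradiction refl j≢j

transpose-fix : ∀ {i j k : Fin n} → k ≢ i → k ≢ j → Perm.transpose i j ⟨$⟩ʳ k ≡ k
transpose-fix {i = i} {j} {k} k≢i k≢j with k Fin.≟ i
... | yes k≡i = contradiction k≡i k≢i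
... | no _ with k Fin.≟ j
...   | yes k≡j = contradiction k≡j k≢j
...   | no _    = refl

permutation-injective : ∀ (σ : Permutation′ n) {i j} → σ ⟨$⟩ʳ i ≡ σ ⟨$⟩ʳ j → i ≡ j
permutation-injective σ = Injection.injective (↔⇒↣ σ)

-- A first transposition takes `i` to `j`; a second takes the image of `k` to `l` and fixes `j`,
-- which differs from both.
permutation-two-points : ∀ {i k j l : Fin n} → i ≢ k → j ≢ l →
  ∃[ σ ] σ ⟨$⟩ʳ i ≡ j × σ ⟨$⟩ʳ k ≡ l
permutation-two-points {i = i} {k} {j} {l} i≢k j≢l =
  τ ∘ₚ Perm.transpose (τ ⟨$⟩ʳ k) l
  , trans (cong (Perm.transpose (τ ⟨$⟩ʳ k) l ⟨$⟩ʳ_) (transposeˡ i j)) (transpose-fix j≢τk j≢l)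
  , transposeˡ (τ ⟨$⟩ʳ k) l
  where
  τ = Perm.transpose i j

  j≢τk : j ≢ τ ⟨$⟩ʳ k
  j≢τk j≡τk = i≢k (permutation-injective τ (trans (transposeˡ i j) j≡τk))

-- For `σ` sending `i` to `j` and `k` to `l`, precomposing with the transposition of `i` and `k`
-- changes the transversal only in these two rows, and both transversals sum to `N`.
exchange : ∀ N (A : Matrix d) → IsGMatrix N A → ∀ i j k l →
  A i j + A k l ≃ A i l + A k j
exchange N A (_ , _ , ∑A≈N) i j k l with i Fin.≟ k | j Fin.≟ l
-- When the rows or the columns coincide no such `σ` is needed: both sides have the same summands.
... | yes refl | _        = +-comm (A i j) (A i l)
... | no _     | yes refl = ≃-refl
... | no i≢k   | no j≢l
  with σ , refl , refl ← permutation-two-points i≢k j≢l = begin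
    A i (σ ⟨$⟩ʳ i) + A k (σ ⟨$⟩ʳ k)      ≈⟨ sum-exchange (entries σ) (entries τ) i≢k agree
                                             (≃-trans {y = N} (wrap (∑A≈N σ)) (≃-sym (wrap (∑A≈N τ)))) ⟩
    A i (τ ⟨$⟩ʳ i) + A k (τ ⟨$⟩ʳ k)      ≡⟨ cong₂ (λ i′ k′ → A i (σ ⟨$⟩ʳ i′) + A k (σ ⟨$⟩ʳ k′))
                                             (transposeˡ i k) (transposeʳ i k) ⟩
    A i (σ ⟨$⟩ʳ k) + A k (σ ⟨$⟩ʳ i)      ∎
  where
  open ≃-Reasoning
  τ = Perm.transpose i k ∘ₚ σ

  entries : Permutation′ _ → Vector ℝ _
  entries ρ q = A q (ρ ⟨$⟩ʳ q)

  agree : ∀ q → q ≢ i → q ≢ k → entries σ q ≃ entries τ q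
  agree q q≢i q≢k = ≃-reflexive (cong (A q ∘ (σ ⟨$⟩ʳ_)) (sym (transpose-fix q≢i q≢k)))

+-cancel-inner : ∀ x y z w → (x + (w + - z)) + (y + - w) ≃ (x + y) + - z
+-cancel-inner x y z w = begin
  (x + (w + - z)) + (y + - w)
    -- The solver knows only commutative monoids, so negatives enter as independent atoms and are
    -- cancelled afterwards.
    ≈⟨ solve 5 (λ x y w w′ z′ → (x ⊕ (w ⊕ z′)) ⊕ (y ⊕ w′) ⊜ ((x ⊕ y) ⊕ z′) ⊕ (w ⊕ w′)) ≃-refl
         x y w (- w) (- z) ⟩
  ((x + y) + - z) + (w + - w)    ≈⟨ +-congˡ (+-inverseʳ w) ⟩
  ((x + y) + - z) + 0ℝ           ≈⟨ +-identityʳ _ ⟩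
  (x + y) + - z                  ∎
  where
  open ≃-Reasoning
  open CommutativeMonoidSolver +-0-commutativeMonoid

decompose : ∀ N (A : Matrix (suc d)) → IsGMatrix N A →
  Σ[ r ∈ Vector ℝ (suc d) ] Σ[ c ∈ Vector ℝ (suc d) ]
  (∀ i → 0ℝ ≼ r i) × (∀ j → 0ℝ ≼ c j) × (∀ i j → A i j ≃ r i + c j)
decompose N A gA@(_ , 0≤A , _) = r , c , 0≼r , 0≼c , A≃r+c
  where
  open ≃-Reasoning
  a = A zero zero
  μ = minimum (A zero)

  r c : Vector ℝ _
  r i = A i zero + (μ + - a)
  c j = A zero j + - μ

  A≃r+c : ∀ i j → A i j ≃ r i + c j
  A≃r+c i j = begin
    A i j                            ≈⟨ [x+z]-z≃x a (A i j) ⟨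
    (A i j + a) + - a                ≈⟨ +-congʳ (exchange N A gA i j zero zero) ⟩
    (A i zero + A zero j) + - a      ≈⟨ +-cancel-inner (A i zero) (A zero j) a μ ⟨
    r i + c j                        ∎

  -- By `exchange`, `A zero j` equals `A i j + a - A i zero`; dropping the nonnegative `A i j`
  -- bounds every entry of row `zero` from below, hence also their minimum.
  a-Aᵢ₀≼μ : ∀ i → a + - A i zero ≼ μ
  a-Aᵢ₀≼μ i = minimum-glb (A zero) λ j → ≼-respʳ (begin
      (A i j + a) + - A i zero             ≈⟨ +-congʳ (exchange N A gA i j zero zero) ⟩
      (A i zero + A zero j) + - A i zero   ≈⟨ +-congʳ (+-comm (A i zero) (A zero j)) ⟩
      (A zero j + A i zero) + - A i zero   ≈⟨ [x+z]-z≃x (A i zero) (A zero j) ⟩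
      A zero j                             ∎)
    (+-mono-≼ (≼-respˡ (+-identityˡ a) (+-mono-≼ (wrap (0≤A i j)) ≼-refl)) ≼-refl)

  0≼r : ∀ i → 0ℝ ≼ r i
  0≼r i = ≼-respˡ (begin
      A i zero + ((a + - A i zero) + - a)
        ≈⟨ solve 4 (λ x x′ a a′ → x ⊕ ((a ⊕ x′) ⊕ a′) ⊜ (x ⊕ x′) ⊕ (a ⊕ a′)) ≃-refl
             (A i zero) (- A i zero) a (- a) ⟩
      (A i zero + - A i zero) + (a + - a)    ≈⟨ +-cong (+-inverseʳ (A i zero)) (+-inverseʳ a) ⟩
      0ℝ + 0ℝ                                ≈⟨ +-identityˡ 0ℝ ⟩
      0ℝ                                     ∎)
    (+-mono-≼ ≼-refl (+-mono-≼ (a-Aᵢ₀≼μ i) ≼-refl))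
    where open CommutativeMonoidSolver +-0-commutativeMonoid

  0≼c : ∀ j → 0ℝ ≼ c j
  0≼c j = ≼-respˡ (+-inverseʳ μ) (+-mono-≼ (minimum-≼ (A zero) j) ≼-refl)

-- Row and column matrices and their convex hull

-- What row and column matrices share. Propositional equality suffices because their entries are
-- literally `0ℝ` or `1ℝ`, and it allows case analysis on entries.
record IsTransversal (M : Matrix d) : Set where
  field
    binary : ∀ i j → M i j ≡ 0ℝ ⊎ M i j ≡ 1ℝ
    single : ∀ (σ : Permutation′ d) → ∃[ p ] M p (σ ⟨$⟩ʳ p) ≡ 1ℝ ×
             (∀ q → q ≢ p → M q (σ ⟨$⟩ʳ q) ≡ 0ℝ)

open IsTransversal

0≢1 : 0ℝ ≢ 1ℝ
0≢1 0≡1 with () ← cong (λ x → seq x 0) 0≡1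

-- Definitionally, `R i k l` is `indicator i k` and `C i k l` is `indicator i l`. It also serves as
-- the point mass in `member∈conv`.
indicator : Fin n → Fin n → ℝ
indicator i k = if ⌊ k Fin.≟ i ⌋ then 1ℝ else 0ℝ

indicator-yes : ∀ {i k : Fin n} → k ≡ i → indicator i k ≡ 1ℝ
indicator-yes {i = i} {k} k≡i with k Fin.≟ i
... | yes _  = refl
... | no k≢i = contradiction k≡i k≢i

indicator-no : ∀ {i k : Fin n} → k ≢ i → indicator i k ≡ 0ℝ
indicator-no {i = i} {k} k≢i with k Fin.≟ i
... | yes k≡i = contradiction k≡i k≢i
... | no _    = refl

indicator-binary : ∀ (i k : Fin n) → indicator i k ≡ 0ℝ ⊎ indicator i k ≡ 1ℝ
indicator-binary i k with k Fin.≟ i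
... | yes _ = inj₂ refl
... | no _  = inj₁ refl

R-transversal : ∀ (i : Fin d) → IsTransversal (R i)
R-transversal i = record
  { binary = λ k _ → indicator-binary i k
  ; single = λ σ → i , indicator-yes refl , λ q → indicator-no
  }

C-transversal : ∀ (i : Fin d) → IsTransversal (C i)
C-transversal i = record
  { binary = λ _ l → indicator-binary i l
  -- The transversal of `σ` meets column `i` in the row that is the preimage of `i`.
  ; single = λ σ → σ ⟨$⟩ˡ i , indicator-yes (Perm.inverseʳ σ) , λ q q≢p →
      indicator-no λ σq≡i → q≢p (permutation-injective σ (trans σq≡i (sym (Perm.inverseʳ σ))))
  }

*-transversal-sum : ∀ x {M : Matrix d} → IsTransversal M → ∀ σ →
  sum (λ i → x * M i (σ ⟨$⟩ʳ i)) ≃ x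
*-transversal-sum x {M} tM σ with p , one , zeros ← single tM σ = begin
  sum (λ i → x * M i (σ ⟨$⟩ʳ i))
    ≈⟨ sum-single _ p (λ q q≢p → ≃-trans (≃-reflexive (cong (x *_) (zeros q q≢p))) (*-zeroʳ x)) ⟩
  x * M p (σ ⟨$⟩ʳ p)    ≡⟨ cong (x *_) one ⟩
  x * 1ℝ                ≈⟨ *-identityʳ x ⟩
  x                     ∎
  where open ≃-Reasoning

*-binary-nonNeg : ∀ {b} → 0ℝ ≼ x → b ≡ 0ℝ ⊎ b ≡ 1ℝ → 0ℝ ≼ x * b
*-binary-nonNeg 0≼x (inj₁ refl) = ≃⇒≽ (*-zeroʳ _)
*-binary-nonNeg 0≼x (inj₂ refl) = ≼-respʳ (≃-sym (*-identityʳ _)) 0≼x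

-- After interchanging the sums, each `S k` contributes exactly its weight `t k` to any transversal.
conv-transversal⊆Gardner : (S : Vector (Matrix d) n) → (∀ k → IsTransversal (S k)) →
  conv S ⊆ Gardner d
conv-transversal⊆Gardner S tS {A} (t , 0≤t , ∑t≈1 , A≈∑tS) =
  unwrap-≼ 0≼1
  , (λ i j → unwrap-≼ (≼-respʳ (≃-sym (wrap {A i j} (A≈∑tS i j)))
      (sum-nonNeg (λ k → t k * S k i j) (λ k → *-binary-nonNeg (wrap (0≤t k)) (binary (tS k) i j)))))
  , λ σ → unwrap-≃ (begin
      sum (λ i → A i (σ ⟨$⟩ʳ i))                             ≈⟨ sum-cong (λ i → wrap (A≈∑tS i (σ ⟨$⟩ʳ i))) ⟩
      sum (λ i → sum (λ k → t k * S k i (σ ⟨$⟩ʳ i)))         ≈⟨ ∑-comm (λ i k → t k * S k i (σ ⟨$⟩ʳ i)) ⟩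
      sum (λ k → sum (λ i → t k * S k i (σ ⟨$⟩ʳ i)))         ≈⟨ sum-cong (λ k → *-transversal-sum (t k) (tS k) σ) ⟩
      sum t                                                  ≈⟨ wrap ∑t≈1 ⟩
      1ℝ                                                     ∎)
  where open ≃-Reasoning

member∈conv : (S : Vector (Matrix d) n) → ∀ k → S k ∈ conv S
member∈conv S k = indicator k
  , (λ l → unwrap-≼ ([ (λ eq → ≼-respʳ (≃-reflexive (sym eq)) ≼-refl)
                     , (λ eq → ≼-respʳ (≃-reflexive (sym eq)) 0≼1) ]′ (indicator-binary k l)))
  , unwrap-≃ (≃-trans (sum-single (indicator k) k (λ l l≢k → ≃-reflexive (indicator-no l≢k)))
                      (≃-reflexive (indicator-yes {i = k} refl)))
  , λ i j → unwrap-≃ (≃-sym (begin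
      sum (λ l → indicator k l * S l i j)
        ≈⟨ sum-single _ k (λ l l≢k →
             ≃-trans (≃-reflexive (cong (_* S l i j) (indicator-no l≢k))) (*-zeroˡ (S l i j))) ⟩
      indicator k k * S k i j    ≡⟨ cong (_* S k i j) (indicator-yes {i = k} refl) ⟩
      1ℝ * S k i j               ≈⟨ *-identityˡ (S k i j) ⟩
      S k i j                    ∎))
  where open ≃-Reasoning

-- The support of B lies in that of M, so each entry of B on the support of M is a whole
-- transversal sum.
support⇒≈ᴹ : {M B : Matrix d} → IsTransversal M → Gardner d B →
  (∀ i j → M i j ≡ 0ℝ → B i j ≼ 0ℝ) → M ≈ᴹ B
support⇒≈ᴹ {M = M} {B} tM (_ , 0≤B , ∑B≈1) supp i j = unwrap-≃ M≃B
  where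
  vanish : ∀ k l → M k l ≡ 0ℝ → B k l ≃ 0ℝ
  vanish k l M≡0 = ≼-antisym (supp k l M≡0) (wrap (0≤B k l))

  M≃B : M i j ≃ B i j
  M≃B with binary tM i j
  ... | inj₁ M≡0 = ≃-trans (≃-reflexive M≡0) (≃-sym (vanish i j M≡0))
  ... | inj₂ M≡1 = begin
    M i j                            ≡⟨ M≡1 ⟩
    1ℝ                               ≈⟨ wrap (∑B≈1 σ) ⟨
    sum (λ k → B k (σ ⟨$⟩ʳ k))       ≈⟨ sum-single _ i (λ q q≢i → vanish q _ (off q q≢i)) ⟩
    B i (σ ⟨$⟩ʳ i)                   ≡⟨ cong (B i) (transposeˡ i j) ⟩
    B i j                            ∎
    where
    open ≃-Reasoning
    σ = Perm.transpose i j

    off : ∀ q → q ≢ i → M q (σ ⟨$⟩ʳ q) ≡ 0ℝ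
    -- The transversal of `σ` passes through the entry 1 at `i`, `j`, so the only row `p` with a 1
    -- must be `i`.
    off q q≢i with p , _ , zeros ← single tM σ with i Fin.≟ p
    ... | yes refl = zeros q q≢i
    ... | no i≢p   = contradiction
      (trans (sym (zeros i i≢p)) (trans (cong (M i) (transposeˡ i j)) M≡1)) 0≢1

transversal∈members : (T : Vector (Matrix d) n) → Gardner d ≐ conv T →
  {M : Matrix d} → IsTransversal M → M ∈ conv T → M ∈ members T
transversal∈members T (_ , conv⊆G) {M} tM (t , 0≤t , ∑t≈1 , M≈∑tT) =
  member (Pos-sum t (Pos-resp-≃ (≃-sym (wrap {sum t} ∑t≈1)) Pos-1))
  where
  T∈G : ∀ l → Gardner _ (T l)
  T∈G l = conv⊆G {T l} (member∈conv T l)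

  member : ∃[ k ] Pos (t k) → M ∈ members T
  -- At a zero of `M`, the term `t k * T k i j` is at most a sum of nonnegative terms equal to 0;
  -- the positive weight then divides out.
  member (k , posₖ) = k , support⇒≈ᴹ tM (T∈G k) λ i j M≡0 → *-cancel-≼0 posₖ
    (≼-respʳ (≃-trans (≃-sym (wrap {M i j} (M≈∑tT i j))) (≃-reflexive M≡0))
      (term≼sum (λ l → t l * T l i j)
        (λ l → *-nonNeg (wrap (0≤t l)) (wrap (proj₁ (proj₂ (T∈G l)) i j))) k))

-- For `d` equal to 1 the row and the column matrix coincide; the repetition is harmless, since only
-- the set of members counts.
lines : ∀ d → Vector (Matrix d) (d ℕ.+ d)
lines d = R ++ C

lines-transversal : ∀ d k → IsTransversal (lines d k)
lines-transversal d k with splitAt d k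
... | inj₁ i = R-transversal i
... | inj₂ i = C-transversal i

sum-*-indicator : (t : Vector ℝ n) → ∀ i → sum (λ l → t l * indicator l i) ≃ t i
sum-*-indicator t i = begin
  sum (λ l → t l * indicator l i)
    ≈⟨ sum-single _ i (λ l l≢i →
         ≃-trans (≃-reflexive (cong (t l *_) (indicator-no (l≢i ∘ sym)))) (*-zeroʳ (t l))) ⟩
  t i * indicator i i    ≡⟨ cong (t i *_) (indicator-yes {i = i} refl) ⟩
  t i * 1ℝ               ≈⟨ *-identityʳ (t i) ⟩
  t i                    ∎
  where open ≃-Reasoning

-- The weights are the `r i` on rows and the `c j` on columns. Their total is the diagonal sum of
-- `A`, the transversal of the identity, hence 1.
r+c∈conv-lines : {A : Matrix d} → Gardner d A → (r c : Vector ℝ d) →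
  (∀ i → 0ℝ ≼ r i) → (∀ j → 0ℝ ≼ c j) → (∀ i j → A i j ≃ r i + c j) → A ∈ conv (lines d)
r+c∈conv-lines {d} {A} (_ , _ , ∑A≈1) r c 0≼r 0≼c A≃r+c =
  r ++ c , (λ k → unwrap-≼ (0≼r++c k)) , unwrap-≃ ∑≃1 , λ i j → unwrap-≃ (≃-sym (combination i j))
  where
  open ≃-Reasoning

  0≼r++c : ∀ k → 0ℝ ≼ (r ++ c) k
  0≼r++c k with splitAt d k
  ... | inj₁ i = 0≼r i
  ... | inj₂ j = 0≼c j

  ∑≃1 : sum (r ++ c) ≃ 1ℝ
  ∑≃1 = begin
    sum (r ++ c)
      ≈⟨ sum-join d (r ++ c) ⟩
    sum (λ i → (r ++ c) (i ↑ˡ d)) + sum (λ j → (r ++ c) (d ↑ʳ j))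
      ≈⟨ +-cong (sum-cong (λ i → ≃-reflexive (lookup-++ˡ r c i)))
                (sum-cong (λ j → ≃-reflexive (lookup-++ʳ r c j))) ⟩
    sum r + sum c                 ≈⟨ ∑-distrib-+ r c ⟨
    sum (λ i → r i + c i)         ≈⟨ sum-cong (λ i → A≃r+c i i) ⟨
    sum (λ i → A i i)             ≈⟨ wrap (∑A≈1 Perm.id) ⟩
    1ℝ                            ∎

  combination : ∀ i j → sum (λ k → (r ++ c) k * lines d k i j) ≃ A i j
  combination i j = begin
    sum (λ k → (r ++ c) k * lines d k i j)
      ≈⟨ sum-join d (λ k → (r ++ c) k * lines d k i j) ⟩
    sum (λ l → (r ++ c) (l ↑ˡ d) * lines d (l ↑ˡ d) i j)
      + sum (λ l → (r ++ c) (d ↑ʳ l) * lines d (d ↑ʳ l) i j)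
      ≈⟨ +-cong
           (sum-cong (λ l → ≃-reflexive
             (cong₂ (λ x M → x * M i j) (lookup-++ˡ r c l) (lookup-++ˡ R C l))))
           (sum-cong (λ l → ≃-reflexive
             (cong₂ (λ x M → x * M i j) (lookup-++ʳ r c l) (lookup-++ʳ R C l)))) ⟩
    sum (λ l → r l * R l i j) + sum (λ l → c l * C l i j)
      ≈⟨ +-cong (sum-*-indicator r i) (sum-*-indicator c j) ⟩
    r i + c j
      ≈⟨ A≃r+c i j ⟨
    A i j ∎

-- Generation, minimality and uniqueness

Gardner⊆conv-lines : Gardner (suc d) ⊆ conv (lines (suc d))
Gardner⊆conv-lines {x = A} gA =
  let r , c , 0≼r , 0≼c , A≃r+c = decompose 1ℝ A gA
  in r+c∈conv-lines {A = A} gA r c 0≼r 0≼c A≃r+c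

Gardner≐conv-lines : Gardner (suc d) ≐ conv (lines (suc d))
Gardner≐conv-lines {d} =
  (λ {A} → Gardner⊆conv-lines {x = A})
  , (λ {A} → conv-transversal⊆Gardner (lines (suc d)) (lines-transversal (suc d)) {A})

-- Holding for every generating `T`, not just for subfamilies, this yields both minimality and one
-- inclusion of uniqueness.
lines⊆members : (T : Vector (Matrix (suc d)) n) → Gardner (suc d) ≐ conv T →
  members (lines (suc d)) ⊆ members T
lines⊆members {d} T G≐conv {A} (k , A≈S) =
  let S = lines (suc d) k
      S∈G = proj₂ Gardner≐conv-lines {S} (member∈conv (lines (suc d)) k)
      l , S≈T = transversal∈members T G≐conv (lines-transversal (suc d) k) (proj₁ G≐conv {S} S∈G)
  in l , λ i j → unwrap-≃ (≃-trans {A i j} {S i j} {T l i j} (wrap (A≈S i j)) (wrap (S≈T i j)))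

lines-vertexSet : IsVertexSet (Gardner (suc d)) (lines (suc d))
lines-vertexSet {d} =
  (Gardner≐conv-lines , λ T _ G≐conv {A} → lines⊆members T G≐conv {A})
  , λ T (G≐conv , minimal) →
      -- `lines` is itself a generating family inside `T`, so the minimality of `T` gives the
      -- reverse inclusion.
      (λ {A} → minimal (lines (suc d)) (λ {B} → lines⊆members T G≐conv {B}) Gardner≐conv-lines {A})
      , (λ {A} → lines⊆members T G≐conv {A})

∈lines⇒ : {A : Matrix d} → A ∈ members (lines d) → (∃[ i ] A ≈ᴹ R i) ⊎ (∃[ i ] A ≈ᴹ C i)
∈lines⇒ {d} (k , A≈) with splitAt d k
... | inj₁ i = inj₁ (i , A≈)
... | inj₂ i = inj₂ (i , A≈)

⇒∈lines : {A : Matrix d} → (∃[ i ] A ≈ᴹ R i) ⊎ (∃[ i ] A ≈ᴹ C i) → A ∈ members (lines d)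
⇒∈lines {d} {A} (inj₁ (i , A≈R)) = i ↑ˡ d , subst (A ≈ᴹ_) (sym (lookup-++ˡ R C i)) A≈R
⇒∈lines {d} {A} (inj₂ (i , A≈C)) = d ↑ʳ i , subst (A ≈ᴹ_) (sym (lookup-++ʳ {m = d} R C i)) A≈C

theorem1 : (d : ℕ) → d ≥ 1 → (A : Matrix d) →
    IsVertex (Gardner d) A ⇔ ((∃[ i ] A ≈ᴹ R i) ⊎ (∃[ i ] A ≈ᴹ C i))
theorem1 (suc d) _ A = mk⇔
  -- The uniqueness of `S` is applied to `lines`, which is minimal generating, so the two have the
  -- same members.
  (λ (_ , S , (_ , unique) , A∈S) →
    ∈lines⇒ {A = A} (proj₂ (unique (lines (suc d)) (proj₁ lines-vertexSet)) {A} A∈S))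
  (λ A∈lines → _ , lines (suc d) , lines-vertexSet , ⇒∈lines {A = A} A∈lines)
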